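{- For any constant $C>0$, there exists no (possibly randomized) algorithm for the classical secretary problem with predictions (in the random order model) whose competitive ratio is better than $\max\{1-C\epsilon, 0.348\}$, where $\epsilon$ is the largest multiplicative prediction error of the instance. That is, there is no randomized algorithm such that for every instance $I$, its ratio $r(I)$ satisfies both $r(I) \ge 1 - C\epsilon(I)$ and $r(I) > 0.348$.
   Context: Classical secretary problem with predictions (random order model): there are $n$ candidates $N=\{1,\dots,n\}$, each with an actual value $v(i)>0$ and a predicted value $\hat v(i)\ge 0$; all predicted values (and $n$) are known to the algorithm in advance. The candidates arrive in an order drawn uniformly at random from all $n!$ permutations; upon arrival of a candidate the algorithm learns its index and actual value and must irrevocably decide whether to hire it; at most one candidate may be hired. The algorithm may use internal randomness. For an instance $I$, $\epsilon(I)=\max_{i\in N}|1-\hat v(i)/v(i)|$, and the ratio $r(I)$ of an algorithm is the expected value (over the random order and the algorithm's randomness) of the hired candidate (0 if none) divided by $\max_{i\in N} v(i)$. -}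

module Defs where

open import Level using () renaming (suc to lsuc; _⊔_ to _⊔ℓ_)
open import Algebra.Bundles using (CommutativeRing)
open import Algebra.Structures using (IsCommutativeRing)
import Algebra.Definitions.RawMonoid as RawMonoidDefinitions
open import Data.Empty using (⊥-elim)
open import Data.Fin.Base using (Fin; zero; suc)
open import Data.List.Base using (List; []; _∷_; map; foldr; concatMap; allFin)
open import Data.List.Relation.Binary.Pointwise using (Pointwise)
open import Data.Nat.Base using (ℕ; zero; suc; NonZero; _!) renaming (_≥_ to _≥ⁿ_)
open import Data.Nat.Properties using (_!≢0)
open import Data.Product.Base using (∃; _×_; _,_; proj₁; proj₂)
open import Data.Sum.Base using (inj₁; inj₂)
open import Function.Base using (_∘_)
open import Relation.Binary.Core using (Rel)
open import Relation.Binary.Definitions using (Cotransitive)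
open import Relation.Binary.Lattice.Definitions using (Supremum)
open import Relation.Binary.PropositionalEquality.Core using (_≡_)
open import Relation.Binary.Structures using (IsStrictPartialOrder)
open import Relation.Nullary.Negation using (¬_)

-- The real numbers, as a Cauchy-complete Archimedean ordered field.
-- Classically these axioms determine ℝ up to isomorphism.  They assume no
-- decidability of the order, so that the constructive Cauchy reals are a
-- model as well.
record RealNumbers c ℓ₁ ℓ₂ : Set (lsuc (c ⊔ℓ ℓ₁ ⊔ℓ ℓ₂)) where
  infix  8 -_
  infixl 7 _*_ _/_
  infixl 6 _+_ _⊔_
  infix  4 _≈_ _<_ _≤_ _≥_

  field
    Carrier : Set c
    _≈_     : Rel Carrier ℓ₁
    _<_     : Rel Carrier ℓ₂
    _+_     : Carrier → Carrier → Carrier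
    _*_     : Carrier → Carrier → Carrier
    _⊔_     : Carrier → Carrier → Carrier
    -_      : Carrier → Carrier
    0#      : Carrier
    1#      : Carrier

  _≤_ : Rel Carrier ℓ₂
  x ≤ y = ¬ (y < x)

  _≥_ : Rel Carrier ℓ₂
  x ≥ y = y ≤ x

  field
    isCommutativeRing    : IsCommutativeRing _≈_ _+_ _*_ -_ 0# 1#
    isStrictPartialOrder : IsStrictPartialOrder _≈_ _<_
    <-cotrans            : Cotransitive _<_
    ≤-antisym            : ∀ {x y} → x ≤ y → y ≤ x → x ≈ y
    ⊔-supremum           : Supremum _≤_ _⊔_
    0<1                  : 0# < 1#
    +-monoʳ-<            : ∀ x {y z} → y < z → (x + y) < (x + z)
    *-positive           : ∀ {x y} → 0# < x → 0# < y → 0# < (x * y)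
    positive-invertible  : ∀ {x} → 0# < x → ∃ λ y → (x * y) ≈ 1#

  commutativeRing : CommutativeRing c ℓ₁
  commutativeRing = record { isCommutativeRing = isCommutativeRing }

  open CommutativeRing commutativeRing public
    using (_-_; +-rawMonoid; +-identityʳ)
  open RawMonoidDefinitions +-rawMonoid using () renaming (_×_ to _·_)
  module Eq = CommutativeRing commutativeRing using (refl; sym; trans)
  module SPO = IsStrictPartialOrder isStrictPartialOrder

  ∣_∣ : Carrier → Carrier
  ∣ x ∣ = x ⊔ (- x)

  fromℕ : ℕ → Carrier
  fromℕ n = n · 1#

  field
    archimedean : ∀ x → ∃ λ n → x < fromℕ n
    complete    : ∀ (s : ℕ → Carrier) →
                  (∀ δ → 0# < δ → ∃ λ N → ∀ i j → i ≥ⁿ N → j ≥ⁿ N → ∣ s i - s j ∣ < δ) →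
                  ∃ λ l → ∀ δ → 0# < δ → ∃ λ N → ∀ i → i ≥ⁿ N → ∣ s i - l ∣ < δ

  Positive : Set (c ⊔ℓ ℓ₂)
  Positive = ∃ λ x → 0# < x

  NonNegative : Set (c ⊔ℓ ℓ₂)
  NonNegative = ∃ λ x → 0# ≤ x

  _/_ : Carrier → Positive → Carrier
  x / (_ , y>0) = x * proj₁ (positive-invertible y>0)

  fromℕ-positive : ∀ n → .{{_ : NonZero n}} → 0# < fromℕ n
  fromℕ-positive (suc zero)    = SPO.<-respʳ-≈ (Eq.sym (+-identityʳ 1#)) 0<1
  fromℕ-positive (suc (suc n)) =
    SPO.trans (fromℕ-positive 1) (+-monoʳ-< 1# (fromℕ-positive (suc n)))

  fromℕ⁺ : ∀ n → .{{_ : NonZero n}} → Positive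
  fromℕ⁺ n = fromℕ n , fromℕ-positive n

  <-≤-positive : ∀ {x y} → 0# < x → x ≤ y → 0# < y
  <-≤-positive {y = y} 0<x x≤y with <-cotrans 0<x y
  ... | inj₁ 0<y = 0<y
  ... | inj₂ y<x = ⊥-elim (x≤y y<x)

  sum : List Carrier → Carrier
  sum = foldr _+_ 0#

  maximum : ∀ {k} → (Fin (suc k) → Carrier) → Carrier
  maximum {zero}  f = f zero
  maximum {suc k} f = f zero ⊔ maximum (f ∘ suc)

  maximum⁺ : ∀ {k} → (Fin (suc k) → Positive) → Positive
  maximum⁺ {k} f = maximum (proj₁ ∘ f) , positive f
    where
    positive : ∀ {k} (f : Fin (suc k) → Positive) → 0# < maximum (proj₁ ∘ f)
    positive {zero}  f = proj₂ (f zero)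
    positive {suc k} f =
      <-≤-positive (proj₂ (f zero)) (proj₁ (⊔-supremum (proj₁ (f zero)) _))

insertions : ∀ {a} {A : Set a} → A → List A → List (List A)
insertions x []       = (x ∷ []) ∷ []
insertions x (y ∷ ys) = (x ∷ y ∷ ys) ∷ map (y ∷_) (insertions x ys)

permutations : ∀ {a} {A : Set a} → List A → List (List A)
permutations []       = [] ∷ []
permutations (x ∷ xs) = concatMap (insertions x) (permutations xs)

module Secretary {c ℓ₁ ℓ₂} (ℝ : RealNumbers c ℓ₁ ℓ₂) where
  open RealNumbers ℝ public

  -- The number of candidates is suc k, so that the maxima below exist.
  record Instance : Set (c ⊔ℓ ℓ₂) where
    field
      k : ℕ

    n : ℕ
    n = suc k

    field
      value      : Fin n → Positive
      prediction : Fin n → NonNegative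

  ε : Instance → Carrier
  ε I = maximum λ i → ∣ 1# - proj₁ (prediction i) / value i ∣
    where open Instance I

  -- What the algorithm learns when a candidate arrives.
  Arrival : ℕ → Set (c ⊔ℓ ℓ₂)
  Arrival n = Fin n × Positive

  _≈ₐ_ : ∀ {n} → Rel (Arrival n) ℓ₁
  (i , x , _) ≈ₐ (j , y , _) = i ≡ j × x ≈ y

  -- hire v̂ past a is the probability of hiring the candidate of the current
  -- arrival a, conditional on having hired none of the earlier arrivals past
  -- (latest first).  Because the algorithm acts only until its first hire,
  -- such conditional probabilities describe any use of internal randomness.
  -- hire-cong says that hire is a function of real numbers, not of the
  -- representatives of their ≈-classes.
  record Algorithm : Set (c ⊔ℓ ℓ₁ ⊔ℓ ℓ₂) where
    field
      hire      : ∀ {n} → (Fin n → NonNegative) → List (Arrival n) → Arrival n → Carrier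
      hire-cong : ∀ {n} {v̂ ŵ : Fin n → NonNegative} {past past′ a a′} →
                  (∀ i → proj₁ (v̂ i) ≈ proj₁ (ŵ i)) → Pointwise _≈ₐ_ past past′ → a ≈ₐ a′ →
                  hire v̂ past a ≈ hire ŵ past′ a′
      0≤hire    : ∀ {n} (v̂ : Fin n → NonNegative) past a → 0# ≤ hire v̂ past a
      hire≤1    : ∀ {n} (v̂ : Fin n → NonNegative) past a → hire v̂ past a ≤ 1#

  module _ (A : Algorithm) (I : Instance) where
    open Algorithm A
    open Instance I

    -- Expected value of the hired candidate when the candidates of the list
    -- are still to arrive, in that order, and none of the past ones was hired.
    expectedFrom : List (Arrival n) → List (Fin n) → Carrier
    expectedFrom past []       = 0#
    expectedFrom past (i ∷ is) = p * proj₁ (value i) + (1# - p) * expectedFrom (a ∷ past) is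
      where
      a = i , value i
      p = hire prediction past a

    expectedValue : Carrier
    expectedValue =
      sum (map (expectedFrom []) (permutations (allFin n))) / fromℕ⁺ (n !) {{n !≢0}}

    ratio : Carrier
    ratio = expectedValue / maximum⁺ value

{-# OPTIONS --safe #-}

-- Consider three candidates with predictions 2, 1, 1.  If the predictions are
-- exact, a ratio of at least 1 forces the algorithm to hire candidate 0 surely
-- when it arrives first with value 2.  Now let the other two candidates have
-- values X and Y = 1000 X, with X ≥ 2, and write p and q for the probabilities
-- that the one of value X, respectively Y, is hired if it arrives first.  The
-- value Y is obtained with probability at most (1/3)(0 + (1 - p) + q), and all
-- other values are at most X, so that a ratio above 0.348 forces
-- q ≥ p + 0.041.  Along the values 2 · 1000ʲ the hiring probabilities thus
-- increase by 0.041 at each step, although they never exceed 1.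
module Submission where

open import Defs
open import Algebra.Bundles using (CommutativeRing)
import Algebra.Properties.Group as GroupProperties
import Algebra.Properties.Semiring.Mult as SemiringMult
import Algebra.Solver.Ring.NaturalCoefficients.Default as NaturalCoefficients
open import Data.Fin.Base using (Fin; zero; suc)
open import Data.Fin.Patterns using (0F; 1F; 2F)
open import Data.List.Base using ([]; _∷_)
open import Data.List.Relation.Unary.All using (All; []; _∷_)
open import Data.Nat.Base as ℕ using (ℕ; zero; suc; nonZero)
open import Data.Product.Base using (∃; _×_; _,_; proj₁; proj₂)
open import Data.Sum.Base using (inj₁; inj₂)
open import Function.Base using (_∘_)
open import Relation.Binary.Structures using (IsPreorder)
open import Relation.Binary.PropositionalEquality.Core as ≡ using (_≡_)
open import Relation.Nullary.Negation using (¬_; contradiction)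
import Relation.Binary.Reasoning.Base.Triple as TripleReasoning

-- Order and arithmetic in an ordered field without decidable order

module OrderedFieldProperties {c ℓ₁ ℓ₂} (ℝ : RealNumbers c ℓ₁ ℓ₂) where
  open RealNumbers ℝ
  open CommutativeRing commutativeRing using
    ( refl; sym; trans; isEquivalence; semiring; commutativeSemiring; +-group
    ; +-congˡ; +-congʳ; +-comm; +-assoc; +-identityˡ; -‿cong; -‿inverseˡ; -‿inverseʳ
    ; *-congˡ; *-congʳ; *-identityˡ; *-identityʳ; zeroˡ; zeroʳ )
  open SemiringMult semiring using (×-homo-+; ×1-homo-*)
  open GroupProperties +-group using () renaming (ε⁻¹≈ε to -0≈0)
  module Solver = NaturalCoefficients commutativeSemiring
  open Solver using (Polynomial; solve; con; _:+_; _:*_; _:=_)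

  -- The semantics of con m brackets the sum 1 + … + 1 differently from fromℕ m.
  :fromℕ : ∀ {n} → ℕ → Polynomial n
  :fromℕ zero    = con 0
  :fromℕ (suc m) = con 1 :+ :fromℕ m

  <⇒≤ : ∀ {x y} → x < y → x ≤ y
  <⇒≤ x<y y<x = SPO.asym x<y y<x

  ≤-reflexive : ∀ {x y} → x ≈ y → x ≤ y
  ≤-reflexive x≈y y<x = SPO.irrefl (sym x≈y) y<x

  -- As `≤` is only the absence of `<`, it admits no case split; cotransitivity places `z` relative
  -- to `x < y`, and one of the two cases contradicts `y ≤ z`.
  <-≤-trans : ∀ {x y z} → x < y → y ≤ z → x < z
  <-≤-trans {z = z} x<y y≤z with <-cotrans x<y z
  ... | inj₁ x<z = x<z
  ... | inj₂ z<y with () ← y≤z z<y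

  ≤-<-trans : ∀ {x y z} → x ≤ y → y < z → x < z
  ≤-<-trans {x = x} x≤y y<z with <-cotrans y<z x
  ... | inj₁ y<x with () ← x≤y y<x
  ... | inj₂ x<z = x<z

  ≤-trans : ∀ {x y z} → x ≤ y → y ≤ z → x ≤ z
  ≤-trans x≤y y≤z z<x = x≤y (≤-<-trans y≤z z<x)

  ≤-isPreorder : IsPreorder _≈_ _≤_
  ≤-isPreorder = record
    { isEquivalence = isEquivalence ; reflexive = ≤-reflexive ; trans = ≤-trans }

  module ≤-Reasoning = TripleReasoning ≤-isPreorder SPO.asym SPO.trans SPO.<-resp-≈
    <⇒≤ <-≤-trans ≤-<-trans
  open ≤-Reasoning

  +-cancelˡ-< : ∀ x {y z} → x + y < x + z → y < z
  +-cancelˡ-< x {y} {z} lt = begin-strict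
    y              ≈⟨ shift y ⟨
    - x + (x + y)  <⟨ +-monoʳ-< (- x) lt ⟩
    - x + (x + z)  ≈⟨ shift z ⟩
    z              ∎
    where
    shift : ∀ w → - x + (x + w) ≈ w
    shift w = trans (sym (+-assoc _ _ _)) (trans (+-congʳ (-‿inverseˡ x)) (+-identityˡ w))

  +-cancelˡ-≤ : ∀ x {y z} → x + y ≤ x + z → y ≤ z
  +-cancelˡ-≤ x le z<y = le (+-monoʳ-< x z<y)

  +-monoʳ-≤ : ∀ x {y z} → y ≤ z → x + y ≤ x + z
  +-monoʳ-≤ x y≤z lt = y≤z (+-cancelˡ-< x lt)

  +-mono-≤ : ∀ {w x y z} → w ≤ x → y ≤ z → w + y ≤ x + z
  +-mono-≤ {w} {x} {y} {z} w≤x y≤z = begin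
    w + y  ≤⟨ +-monoʳ-≤ w y≤z ⟩
    w + z  ≈⟨ +-comm w z ⟩
    z + w  ≤⟨ +-monoʳ-≤ z w≤x ⟩
    z + x  ≈⟨ +-comm z x ⟩
    x + z  ∎

  x+y-x≈y : ∀ x y → x + (y - x) ≈ y
  x+y-x≈y x y = begin-equality
    x + (y - x)  ≈⟨ solve 3 (λ x y m → x :+ (y :+ m) := y :+ (x :+ m)) refl x y (- x) ⟩
    y + (x - x)  ≈⟨ +-congˡ (-‿inverseʳ x) ⟩
    y + 0#       ≈⟨ +-identityʳ y ⟩
    y            ∎

  x≤y⇒0≤y-x : ∀ {x y} → x ≤ y → 0# ≤ y - x
  x≤y⇒0≤y-x {x} {y} x≤y = +-cancelˡ-≤ x (begin
    x + 0#       ≈⟨ +-identityʳ x ⟩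
    x            ≤⟨ x≤y ⟩
    y            ≈⟨ x+y-x≈y x y ⟨
    x + (y - x)  ∎)

  -- A nonnegative number is, up to double negation, zero or positive.
  *-nonNegative : ∀ {x y} → 0# ≤ x → 0# ≤ y → 0# ≤ x * y
  *-nonNegative {x} {y} 0≤x 0≤y xy<0 = x≮0∨x≯0 (λ 0<x → y≮0∨y≯0 (λ 0<y →
      SPO.asym xy<0 (*-positive 0<x 0<y)))
    where
    x≮0∨x≯0 : ¬ ¬ (0# < x)
    x≮0∨x≯0 x≤0 =
      SPO.irrefl (trans (*-congʳ (≤-antisym x≤0 0≤x)) (zeroˡ y)) xy<0
    y≮0∨y≯0 : ¬ ¬ (0# < y)
    y≮0∨y≯0 y≤0 =
      SPO.irrefl (trans (*-congˡ (≤-antisym y≤0 0≤y)) (zeroʳ x)) xy<0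

  *-monoʳ-≤ : ∀ {x y z} → 0# ≤ x → y ≤ z → x * y ≤ x * z
  *-monoʳ-≤ {x} {y} {z} 0≤x y≤z = begin
    x * y                ≈⟨ +-identityʳ _ ⟨
    x * y + 0#           ≤⟨ +-monoʳ-≤ _ (*-nonNegative 0≤x (x≤y⇒0≤y-x y≤z)) ⟩
    x * y + x * (z - y)  ≈⟨ solve 3 (λ x y d → x :* y :+ x :* d := x :* (y :+ d)) refl x y (z - y) ⟩
    x * (y + (z - y))    ≈⟨ *-congˡ (x+y-x≈y y z) ⟩
    x * z                ∎

  *-monoʳ-< : ∀ {x y z} → 0# < x → y < z → x * y < x * z
  *-monoʳ-< {x} {y} {z} 0<x y<z = begin-strict
    x * y                ≈⟨ +-identityʳ _ ⟨
    x * y + 0#           <⟨ +-monoʳ-< _ (*-positive 0<x 0<z-y) ⟩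
    x * y + x * (z - y)  ≈⟨ solve 3 (λ x y d → x :* y :+ x :* d := x :* (y :+ d)) refl x y (z - y) ⟩
    x * (y + (z - y))    ≈⟨ *-congˡ (x+y-x≈y y z) ⟩
    x * z                ∎
    where
    0<z-y : 0# < z - y
    0<z-y = +-cancelˡ-< y (begin-strict
      y + 0#       ≈⟨ +-identityʳ y ⟩
      y            <⟨ y<z ⟩
      z            ≈⟨ x+y-x≈y y z ⟨
      y + (z - y)  ∎)

  *-cancelˡ-≤ : ∀ {x y z} → 0# < x → x * y ≤ x * z → y ≤ z
  *-cancelˡ-≤ 0<x le z<y = le (*-monoʳ-< 0<x z<y)

  -- With this identity divisions are cleared instead of being computed with.
  /-cancel : ∀ x (y : Positive) → proj₁ y * (x / y) ≈ x
  /-cancel x (y , y>0) with positive-invertible y>0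
  ... | z , yz≈1 = begin-equality
    y * (x * z)  ≈⟨ solve 3 (λ x y z → y :* (x :* z) := x :* (y :* z)) refl x y z ⟩
    x * (y * z)  ≈⟨ *-congˡ yz≈1 ⟩
    x * 1#       ≈⟨ *-identityʳ x ⟩
    x            ∎

  fromℕ-+ : ∀ m n → fromℕ (m ℕ.+ n) ≈ fromℕ m + fromℕ n
  fromℕ-+ = ×-homo-+ 1#

  fromℕ-* : ∀ m n → fromℕ (m ℕ.* n) ≈ fromℕ m * fromℕ n
  fromℕ-* = ×1-homo-*

  fromℕ-nonNegative : ∀ n → 0# ≤ fromℕ n
  fromℕ-nonNegative zero    = ≤-reflexive refl
  fromℕ-nonNegative (suc n) = <⇒≤ (fromℕ-positive (suc n))

  x≤1000*x : ∀ {x} → 0# ≤ x → x ≤ fromℕ 1000 * x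
  x≤1000*x {x} 0≤x = begin
    x                     ≈⟨ +-identityʳ x ⟨
    x + 0#                ≤⟨ +-monoʳ-≤ x (*-nonNegative (fromℕ-nonNegative 999) 0≤x) ⟩
    x + fromℕ 999 * x     ≈⟨ solve 2 (λ x k → x :+ k :* x := (con 1 :+ k) :* x) refl x (fromℕ 999) ⟩
    (1# + fromℕ 999) * x  ∎

  -- Finite maxima, absolute value and convex combinations

  maximum-upper : ∀ {k} (f : Fin (suc k) → Carrier) i → f i ≤ maximum f
  maximum-upper {zero}  f zero    = ≤-reflexive refl
  maximum-upper {suc k} f zero    = proj₁ (⊔-supremum _ _)
  maximum-upper {suc k} f (suc i) =
    ≤-trans (maximum-upper (f ∘ suc) i) (proj₁ (proj₂ (⊔-supremum _ _)))

  maximum-least : ∀ {k} (f : Fin (suc k) → Carrier) {b} → (∀ i → f i ≤ b) → maximum f ≤ b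
  maximum-least {zero}  f f≤b = f≤b zero
  maximum-least {suc k} f f≤b =
    proj₂ (proj₂ (⊔-supremum _ _)) _ (f≤b zero) (maximum-least (f ∘ suc) (f≤b ∘ suc))

  x≈0⇒∣x∣≤0 : ∀ {x} → x ≈ 0# → ∣ x ∣ ≤ 0#
  x≈0⇒∣x∣≤0 x≈0 = proj₂ (proj₂ (⊔-supremum _ _)) _ (≤-reflexive x≈0)
    (≤-reflexive (trans (-‿cong x≈0) -0≈0))

  p*x+[1-p]*x≈x : ∀ p x → p * x + (1# - p) * x ≈ x
  p*x+[1-p]*x≈x p x = begin-equality
    p * x + (1# - p) * x  ≈⟨ solve 3 (λ p q x → p :* x :+ q :* x := (p :+ q) :* x) refl p (1# - p) x ⟩
    (p + (1# - p)) * x    ≈⟨ *-congʳ (x+y-x≈y p 1#) ⟩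
    1# * x                ≈⟨ *-identityˡ x ⟩
    x                     ∎

-- Bounds on the expected value and the ratio

module SecretaryProperties {c ℓ₁ ℓ₂} (ℝ : RealNumbers c ℓ₁ ℓ₂) where
  open Secretary ℝ
  open OrderedFieldProperties ℝ
  open CommutativeRing commutativeRing using
    ( refl; sym; trans; +-cong; +-congˡ; +-congʳ; +-comm; +-identityˡ; -‿cong; -‿inverseʳ
    ; *-congˡ; *-congʳ; *-comm; *-assoc; *-identityˡ; *-identityʳ; zeroʳ )
  open Solver using (solve; con; _:+_; _:*_; _:=_)
  open ≤-Reasoning

  -- Each `1 - v̂/v` vanishes, hence so does the bound on its absolute value. For positive `C` this
  -- gives `1 - C * ε I ≥ 1`.
  exact⇒ε≤0 : ∀ I → (∀ i → proj₁ (Instance.prediction I i) ≈ proj₁ (Instance.value I i)) →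
              ε I ≤ 0#
  exact⇒ε≤0 I exact = maximum-least _ (λ i → x≈0⇒∣x∣≤0 (1-v̂/v≈0 i))
    where
    open Instance I
    1-v̂/v≈0 : ∀ i → 1# - proj₁ (prediction i) / value i ≈ 0#
    1-v̂/v≈0 i = trans (+-congˡ (-‿cong v̂/v≈1)) (-‿inverseʳ 1#)
      where
      v̂/v≈1 : proj₁ (prediction i) / value i ≈ 1#
      v̂/v≈1 = trans (*-congʳ (exact i)) (proj₂ (positive-invertible (proj₂ (value i))))

  module _ (A : Algorithm) where
    open Algorithm A

    module _ (I : Instance) where
      open Instance I

      firstHire : Fin n → Carrier
      firstHire i = hire prediction [] (i , value i)

      expectedFrom-step : ∀ past i is {M} → expectedFrom A I ((i , value i) ∷ past) is ≤ M →
        let p = hire prediction past (i , value i) in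
        expectedFrom A I past (i ∷ is) ≤ p * proj₁ (value i) + (1# - p) * M
      expectedFrom-step past i is e≤M =
        +-monoʳ-≤ _ (*-monoʳ-≤ (x≤y⇒0≤y-x (hire≤1 _ _ _)) e≤M)

      -- Each decision forms a convex combination of two quantities at most `M`; `0 ≤ M` covers the
      -- end of the list, where nobody is hired.
      expectedFrom-upper : ∀ {M} → 0# ≤ M → ∀ past {is} →
        All (λ i → proj₁ (value i) ≤ M) is → expectedFrom A I past is ≤ M
      expectedFrom-upper 0≤M past []          = 0≤M
      expectedFrom-upper {M} 0≤M past {i ∷ is} (v≤M ∷ vs≤M) = begin
        expectedFrom A I past (i ∷ is)      ≤⟨ expectedFrom-step past i is (expectedFrom-upper 0≤M _ vs≤M) ⟩
        p * proj₁ (value i) + (1# - p) * M  ≤⟨ +-mono-≤ (*-monoʳ-≤ (0≤hire _ _ _) v≤M) (≤-reflexive refl) ⟩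
        p * M + (1# - p) * M                ≈⟨ p*x+[1-p]*x≈x p M ⟩
        M                                   ∎
        where p = hire prediction past (i , value i)

      -- Multiplying by the maximum clears the division. The conclusion speaks of an arbitrary
      -- candidate, so the maximum itself never has to be evaluated.
      ratio-lower⇒ : ∀ {b} → 0# ≤ b → b ≤ ratio A I → ∀ i → b * proj₁ (value i) ≤ expectedValue A I
      ratio-lower⇒ {b} 0≤b b≤r i = begin
        b * proj₁ (value i)      ≤⟨ *-monoʳ-≤ 0≤b (maximum-upper _ i) ⟩
        b * m                    ≈⟨ *-comm b m ⟩
        m * b                    ≤⟨ *-monoʳ-≤ (<⇒≤ (proj₂ (maximum⁺ value))) b≤r ⟩
        m * ratio A I            ≈⟨ /-cancel _ (maximum⁺ value) ⟩
        expectedValue A I        ∎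
        where m = proj₁ (maximum⁺ value)

    -- `M i` stands for a bound on what is still attainable once `i` came first and was rejected;
    -- the decision on `i` itself is kept exact.
    firstArrivalBound : (I : Instance) → (Fin (Instance.n I) → Carrier) → Fin (Instance.n I) → Carrier
    firstArrivalBound I M i = p * proj₁ (Instance.value I i) + (1# - p) * M i
      where p = firstHire I i

  predicted : Fin 3 → Positive
  predicted zero    = fromℕ⁺ 2
  predicted (suc _) = fromℕ⁺ 1

  instance₃ : (Fin 3 → Positive) → Instance
  instance₃ v = record
    { k          = 2
    ; value      = v
    ; prediction = λ i → proj₁ (predicted i) , <⇒≤ (proj₂ (predicted i))
    }

  values : Positive → Positive → Fin 3 → Positive
  values x y zero             = predicted zero
  values x y (suc zero)       = x
  values x y (suc (suc zero)) = y

  -- The value 2 · 1000^j; the recursion makes consecutive levels differ by the factor 1000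
  -- definitionally.
  level : ℕ → Positive
  level zero    = fromℕ⁺ 2
  level (suc j) = fromℕ 1000 * proj₁ (level j) , *-positive (fromℕ-positive 1000) (proj₂ (level j))

  2≤level : ∀ j → fromℕ 2 ≤ proj₁ (level j)
  2≤level zero    = ≤-reflexive refl
  2≤level (suc j) = ≤-trans (2≤level j) (x≤1000*x (<⇒≤ (proj₂ (level j))))

  -- Averaging over the first arrival among three candidates

  module _ (A : Algorithm) where
    open Algorithm A

    -- Each candidate opens two of the six orders. After an opening by `i` only the other two values
    -- remain, so `M i` bounds the continuation whatever the later decisions are.
    3*expectedValue-upper : ∀ v M → (∀ i j → ¬ (i ≡ j) → proj₁ (v j) ≤ M i) →
      let b = firstArrivalBound A (instance₃ v) M in
      fromℕ 3 * expectedValue A (instance₃ v) ≤ b zero + b (suc zero) + b (suc (suc zero))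
    3*expectedValue-upper v M others≤M = *-cancelˡ-≤ (fromℕ-positive 2) (begin
        fromℕ 2 * (fromℕ 3 * e)
          ≈⟨ solve 1 (λ e → :fromℕ 2 :* (:fromℕ 3 :* e) := :fromℕ 6 :* e) refl e ⟩
        fromℕ 6 * e
          ≈⟨ /-cancel _ (fromℕ⁺ 6) ⟩
        _
          -- The summands follow the order in which `permutations` lists the arrival orders.
          ≤⟨ +-mono-≤ (first≤b 0F 1F 2F (λ ()) (λ ())) (
             +-mono-≤ (first≤b 1F 0F 2F (λ ()) (λ ())) (
             +-mono-≤ (first≤b 1F 2F 0F (λ ()) (λ ())) (
             +-mono-≤ (first≤b 0F 2F 1F (λ ()) (λ ())) (
             +-mono-≤ (first≤b 2F 0F 1F (λ ()) (λ ())) (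
             +-mono-≤ (first≤b 2F 1F 0F (λ ()) (λ ())) (≤-reflexive refl)))))) ⟩
        b 0F + (b 1F + (b 1F + (b 0F + (b 2F + (b 2F + 0#)))))
          ≈⟨ solve 3 (λ x y z → x :+ (y :+ (y :+ (x :+ (z :+ (z :+ con 0))))) := :fromℕ 2 :* (x :+ y :+ z))
               refl (b 0F) (b 1F) (b 2F) ⟩
        fromℕ 2 * (b 0F + b 1F + b 2F) ∎)
      where
      I = instance₃ v
      e = expectedValue A I
      b = firstArrivalBound A I M
      first≤b : ∀ i j l → ¬ (i ≡ j) → ¬ (i ≡ l) → expectedFrom A I [] (i ∷ j ∷ l ∷ []) ≤ b i
      first≤b i j l i≢j i≢l = expectedFrom-step A I [] i (j ∷ l ∷ [])
        (expectedFrom-upper A I (≤-trans (<⇒≤ (proj₂ (v j))) vⱼ≤M) _ (vⱼ≤M ∷ others≤M i l i≢l ∷ []))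
        where vⱼ≤M = others≤M i j i≢j

    -- All `instance₃ v` share their predictions, so by computation this is `firstHire` in each of
    -- them that gives candidate `i` the value `x`: the decision on a first arrival cannot depend on
    -- the other values.
    hireProbability : Fin 3 → Positive → Carrier
    hireProbability i x = hire (Instance.prediction (instance₃ predicted)) [] (i , x)

    Best-when-exact : Set _
    Best-when-exact = proj₁ (predicted 0F) ≤ expectedValue A (instance₃ predicted)

    -- Candidate 0 arriving first yields at most 2p + (1 - p) = 1 + p and each other opening at most
    -- 2, so 3 · 2 ≤ 1 + p + 4 and p ≥ 1.
    best-hired : Best-when-exact → hireProbability 0F (predicted 0F) ≈ 1#
    best-hired 2≤e = ≤-antisym (hire≤1 _ _ _) (+-cancelˡ-≤ (1# + fromℕ 4) (begin
        1# + fromℕ 4 + 1#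
          ≈⟨ solve 0 (con 1 :+ :fromℕ 4 :+ con 1 := :fromℕ 3 :* :fromℕ 2) refl ⟩
        fromℕ 3 * fromℕ 2
          ≤⟨ *-monoʳ-≤ (fromℕ-nonNegative 3) 2≤e ⟩
        fromℕ 3 * expectedValue A I
          ≤⟨ 3*expectedValue-upper predicted M others≤M ⟩
        p * fromℕ 2 + (1# - p) * fromℕ 1 + b 1F + b 2F
          ≤⟨ +-mono-≤ (+-mono-≤ (≤-reflexive refl) (b≤2 0F)) (b≤2 1F) ⟩
        p * fromℕ 2 + (1# - p) * fromℕ 1 + fromℕ 2 + fromℕ 2
          ≈⟨ solve 2 (λ p q → p :* :fromℕ 2 :+ q :* :fromℕ 1 :+ :fromℕ 2 :+ :fromℕ 2
                        := p :+ q :+ :fromℕ 4 :+ p) refl p (1# - p) ⟩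
        p + (1# - p) + fromℕ 4 + p
          ≈⟨ +-congʳ (+-congʳ (x+y-x≈y p 1#)) ⟩
        1# + fromℕ 4 + p ∎))
      where
      1≤2 : fromℕ 1 ≤ fromℕ 2
      1≤2 = +-monoʳ-≤ 1# (fromℕ-nonNegative 1)
      I = instance₃ predicted
      p = hireProbability 0F (predicted 0F)
      M : Fin 3 → Carrier
      M zero    = fromℕ 1
      M (suc _) = fromℕ 2
      others≤M : ∀ i j → ¬ (i ≡ j) → proj₁ (predicted j) ≤ M i
      others≤M zero    zero    i≢j = contradiction ≡.refl i≢j
      others≤M zero    (suc _) _ = ≤-reflexive refl
      others≤M (suc _) zero    _ = ≤-reflexive refl
      others≤M (suc _) (suc _) _ = 1≤2
      b = firstArrivalBound A I M
      b≤2 : ∀ i → b (suc i) ≤ fromℕ 2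
      b≤2 i = begin
        q * fromℕ 1 + (1# - q) * fromℕ 2  ≤⟨ +-mono-≤ (*-monoʳ-≤ (0≤hire _ _ _) 1≤2) (≤-reflexive refl) ⟩
        q * fromℕ 2 + (1# - q) * fromℕ 2  ≈⟨ p*x+[1-p]*x≈x q (fromℕ 2) ⟩
        fromℕ 2                           ∎
        where q = hireProbability (suc i) (predicted (suc i))

    -- Deviating instances with values 2, X and Y = 1000 X

    module Deviation (hired : hireProbability 0F (predicted 0F) ≈ 1#)
                     (x y : Positive) (2≤x : fromℕ 2 ≤ proj₁ x)
                     (1000x≈y : fromℕ 1000 * proj₁ x ≈ proj₁ y) where

      X = proj₁ x
      Y = proj₁ y

      X≤Y : X ≤ Y
      X≤Y = ≤-trans (x≤1000*x (<⇒≤ (proj₂ x))) (≤-reflexive 1000x≈y)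

      -- A first arrival of candidate 0 looks as in the exact instance, so it is hired for 2 and `Y`
      -- is forgone; 2 is then rounded up to `X`.
      sureHire-upper : let p = hireProbability 0F (predicted 0F) in
                       p * fromℕ 2 + (1# - p) * Y ≤ X
      sureHire-upper = begin
        p * fromℕ 2 + (1# - p) * Y  ≈⟨ +-cong (*-congʳ hired) (*-congʳ 1-p≈0) ⟩
        1# * fromℕ 2 + 0# * Y       ≈⟨ solve 2 (λ t y → con 1 :* t :+ con 0 :* y := t) refl (fromℕ 2) Y ⟩
        fromℕ 2                     ≤⟨ 2≤x ⟩
        X                           ∎
        where
        p = hireProbability 0F (predicted 0F)
        1-p≈0 : 1# - p ≈ 0#
        1-p≈0 = trans (+-congˡ (-‿cong hired)) (-‿inverseʳ 1#)

      -- Here and in `high-upper` the share of value `X` is rounded up to `X`, which leaves hiring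
      -- probabilities only in the coefficients of `Y`.
      low-upper : ∀ i → let p = hireProbability i x in
                  p * X + (1# - p) * Y ≤ X + (1# - p) * Y
      low-upper i = +-mono-≤ p*X≤X (≤-reflexive refl)
        where
        p = hireProbability i x
        p*X≤X : p * X ≤ X
        p*X≤X = begin
          p * X   ≈⟨ *-comm p X ⟩
          X * p   ≤⟨ *-monoʳ-≤ (<⇒≤ (proj₂ x)) (hire≤1 _ _ _) ⟩
          X * 1#  ≈⟨ *-identityʳ X ⟩
          X       ∎

      high-upper : ∀ i → let q = hireProbability i y in
                   q * Y + (1# - q) * X ≤ q * Y + X
      high-upper i = +-monoʳ-≤ _ (begin
        (1# - q) * X                  ≈⟨ +-identityˡ _ ⟨
        0# + (1# - q) * X             ≤⟨ +-mono-≤ (*-nonNegative (0≤hire _ _ _) (<⇒≤ (proj₂ x))) (≤-reflexive refl) ⟩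
        q * X + (1# - q) * X          ≈⟨ p*x+[1-p]*x≈x q X ⟩
        X                             ∎)
        where q = hireProbability i y

      -- The constant is 3 · 348 − 1000 − 3.
      gap : ∀ {p q e} → fromℕ 348 * Y ≤ fromℕ 1000 * e →
            fromℕ 3 * e ≤ X + (X + (1# - p) * Y) + (q * Y + X) →
            fromℕ 1000 * p + fromℕ 41 ≤ fromℕ 1000 * q
      gap {p} {q} {e} lower upper = +-cancelˡ-≤ (fromℕ 3 + t) (begin
          fromℕ 3 + t + (t * p + fromℕ 41)
            ≈⟨ solve 4 (λ a t p d → a :+ t :+ (t :* p :+ d) := t :* p :+ (t :+ (d :+ a)))
                 refl (fromℕ 3) t p (fromℕ 41) ⟩
          t * p + (t + (fromℕ 41 + fromℕ 3))
            ≈⟨ +-congˡ (trans (+-congˡ (sym (fromℕ-+ 41 3))) (sym (fromℕ-+ 1000 44))) ⟩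
          t * p + fromℕ 1044
            ≈⟨ +-congˡ (fromℕ-* 3 348) ⟩
          t * p + fromℕ 3 * fromℕ 348
            -- Dividing out the positive `Y` leaves a comparison free of the values.
            ≤⟨ +-monoʳ-≤ _ (*-cancelˡ-≤ (proj₂ y) scaled) ⟩
          t * p + (fromℕ 3 + t * ((1# - p) + q))
            ≈⟨ solve 5 (λ a t p p̄ q → t :* p :+ (a :+ t :* (p̄ :+ q)) := a :+ t :* (p :+ p̄) :+ t :* q)
                 refl (fromℕ 3) t p (1# - p) q ⟩
          fromℕ 3 + t * (p + (1# - p)) + t * q
            ≈⟨ +-congʳ (+-congˡ (trans (*-congˡ (x+y-x≈y p 1#)) (*-identityʳ t))) ⟩
          fromℕ 3 + t + t * q ∎)
        where
        t = fromℕ 1000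
        scaled : Y * (fromℕ 3 * fromℕ 348) ≤ Y * (fromℕ 3 + t * ((1# - p) + q))
        scaled = begin
          Y * (fromℕ 3 * fromℕ 348)
            ≈⟨ solve 3 (λ y a h → y :* (a :* h) := a :* (h :* y)) refl Y (fromℕ 3) (fromℕ 348) ⟩
          fromℕ 3 * (fromℕ 348 * Y)
            ≤⟨ *-monoʳ-≤ (fromℕ-nonNegative 3) lower ⟩
          fromℕ 3 * (t * e)
            ≈⟨ solve 3 (λ a t e → a :* (t :* e) := t :* (a :* e)) refl (fromℕ 3) t e ⟩
          t * (fromℕ 3 * e)
            ≤⟨ *-monoʳ-≤ (fromℕ-nonNegative 1000) upper ⟩
          t * (X + (X + (1# - p) * Y) + (q * Y + X))
            ≈⟨ solve 5 (λ t x y p̄ q → t :* (x :+ (x :+ p̄ :* y) :+ (q :* y :+ x))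
                          := :fromℕ 3 :* (t :* x) :+ y :* (t :* (p̄ :+ q)))
                 refl t X Y (1# - p) q ⟩
          fromℕ 3 * (t * X) + Y * (t * ((1# - p) + q))
            -- The three terms `X`, multiplied by 1000, become `3 Y`; this makes `Y` a common
            -- factor.
            ≈⟨ +-congʳ (*-congˡ 1000x≈y) ⟩
          fromℕ 3 * Y + Y * (t * ((1# - p) + q))
            ≈⟨ solve 3 (λ a y z → a :* y :+ y :* z := y :* (a :+ z)) refl (fromℕ 3) Y _ ⟩
          Y * (fromℕ 3 + t * ((1# - p) + q)) ∎

      -- Candidate 1 holds `X` and candidate 2 holds `Y`. Rejecting the first arrival leaves at most
      -- `Y`, and at most `X` if that arrival was candidate 2.
      gap₁₂ : fromℕ 348 * Y ≤ fromℕ 1000 * expectedValue A (instance₃ (values x y)) →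
              fromℕ 1000 * hireProbability 1F x + fromℕ 41 ≤ fromℕ 1000 * hireProbability 2F y
      gap₁₂ lower = gap lower (≤-trans (3*expectedValue-upper (values x y) M others≤M)
          (+-mono-≤ (+-mono-≤ sureHire-upper (low-upper 1F)) (high-upper 2F)))
        where
        M : Fin 3 → Carrier
        M zero             = Y
        M (suc zero)       = Y
        M (suc (suc zero)) = X
        others≤M : ∀ i j → ¬ (i ≡ j) → proj₁ (values x y j) ≤ M i
        others≤M zero             zero             i≢j = contradiction ≡.refl i≢j
        others≤M zero             (suc zero)       _ = X≤Y
        others≤M zero             (suc (suc zero)) _ = ≤-reflexive refl
        others≤M (suc zero)       zero             _ = ≤-trans 2≤x X≤Y
        others≤M (suc zero)       (suc zero)       _ = X≤Y
        others≤M (suc zero)       (suc (suc zero)) _ = ≤-reflexive refl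
        others≤M (suc (suc zero)) zero             _ = 2≤x
        others≤M (suc (suc zero)) (suc zero)       _ = ≤-reflexive refl
        others≤M (suc (suc zero)) (suc (suc zero)) i≢j = contradiction ≡.refl i≢j

      -- The mirror image with the values exchanged. Each of the two inequalities passes from one
      -- candidate to the other, so the induction over the levels uses both.
      gap₂₁ : fromℕ 348 * Y ≤ fromℕ 1000 * expectedValue A (instance₃ (values y x)) →
              fromℕ 1000 * hireProbability 2F x + fromℕ 41 ≤ fromℕ 1000 * hireProbability 1F y
      gap₂₁ lower = gap lower (begin
          fromℕ 3 * expectedValue A (instance₃ (values y x))
            ≤⟨ 3*expectedValue-upper (values y x) M others≤M ⟩
          _
            ≤⟨ +-mono-≤ (+-mono-≤ sureHire-upper (high-upper 1F)) (low-upper 2F) ⟩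
          X + (q * Y + X) + (X + (1# - p) * Y)
            -- `gap` expects the low candidate before the high one.
            ≈⟨ solve 3 (λ x l h → x :+ h :+ l := x :+ l :+ h) refl X (X + (1# - p) * Y) (q * Y + X) ⟩
          X + (X + (1# - p) * Y) + (q * Y + X) ∎)
        where
        p = hireProbability 2F x
        q = hireProbability 1F y
        M : Fin 3 → Carrier
        M zero             = Y
        M (suc zero)       = X
        M (suc (suc zero)) = Y
        others≤M : ∀ i j → ¬ (i ≡ j) → proj₁ (values y x j) ≤ M i
        others≤M zero             zero             i≢j = contradiction ≡.refl i≢j
        others≤M zero             (suc zero)       _ = ≤-reflexive refl
        others≤M zero             (suc (suc zero)) _ = X≤Y
        others≤M (suc zero)       zero             _ = 2≤x
        others≤M (suc zero)       (suc zero)       i≢j = contradiction ≡.refl i≢j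
        others≤M (suc zero)       (suc (suc zero)) _ = ≤-reflexive refl
        others≤M (suc (suc zero)) zero             _ = ≤-trans 2≤x X≤Y
        others≤M (suc (suc zero)) (suc zero)       _ = ≤-reflexive refl
        others≤M (suc (suc zero)) (suc (suc zero)) _ = X≤Y

    -- Both candidates share one induction, since each step compares a level at one candidate with
    -- the next level at the other.
    hireProbability-grows : hireProbability 0F (predicted 0F) ≈ 1# →
      (∀ I i → fromℕ 348 * proj₁ (Instance.value I i) ≤ fromℕ 1000 * expectedValue A I) →
      ∀ j → fromℕ (j ℕ.* 41) ≤ fromℕ 1000 * hireProbability 1F (level j)
          × fromℕ (j ℕ.* 41) ≤ fromℕ 1000 * hireProbability 2F (level j)
    hireProbability-grows hired lower zero    = 0≤1000*p , 0≤1000*p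
      where
      0≤1000*p : ∀ {i} → 0# ≤ fromℕ 1000 * hireProbability i (level 0)
      0≤1000*p = *-nonNegative (fromℕ-nonNegative 1000) (0≤hire _ _ _)
    hireProbability-grows hired lower (suc j) =
        -- The competitive bound is applied to the candidate of value `y`: candidate 1 here,
        -- candidate 2 in the second component.
        next (proj₂ previous) (gap₂₁ (lower (instance₃ (values y x)) 1F))
      , next (proj₁ previous) (gap₁₂ (lower (instance₃ (values x y)) 2F))
      where
      x = level j
      y = level (suc j)
      previous = hireProbability-grows hired lower j
      open Deviation hired x y (2≤level j) refl
      next : ∀ {p q} → fromℕ (j ℕ.* 41) ≤ fromℕ 1000 * p → fromℕ 1000 * p + fromℕ 41 ≤ fromℕ 1000 * q →
             fromℕ (suc j ℕ.* 41) ≤ fromℕ 1000 * q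
      next {p} {q} le p+41≤q = begin
        fromℕ (41 ℕ.+ j ℕ.* 41)         ≈⟨ fromℕ-+ 41 (j ℕ.* 41) ⟩
        fromℕ 41 + fromℕ (j ℕ.* 41)     ≈⟨ +-comm _ _ ⟩
        fromℕ (j ℕ.* 41) + fromℕ 41     ≤⟨ +-mono-≤ le (≤-reflexive refl) ⟩
        fromℕ 1000 * p + fromℕ 41       ≤⟨ p+41≤q ⟩
        fromℕ 1000 * q                  ∎

    ratio-bounded : hireProbability 0F (predicted 0F) ≈ 1# →
      ¬ (∀ I i → fromℕ 348 * proj₁ (Instance.value I i) ≤ fromℕ 1000 * expectedValue A I)
    ratio-bounded hired lower = 1025≤1000 (begin-strict
        fromℕ 1000              ≈⟨ +-identityʳ _ ⟨
        fromℕ 1000 + 0#         <⟨ +-monoʳ-< _ (fromℕ-positive 25) ⟩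
        fromℕ 1000 + fromℕ 25   ≈⟨ fromℕ-+ 1000 25 ⟨
        fromℕ 1025              ∎)
      where
      1025≤1000 : fromℕ 1025 ≤ fromℕ 1000
      1025≤1000 = begin
        -- 25 steps are the first to exceed 1000: 24 · 41 = 984 and 25 · 41 = 1025.
        fromℕ 1025                                    ≤⟨ proj₁ (hireProbability-grows hired lower 25) ⟩
        fromℕ 1000 * hireProbability 1F (level 25)  ≤⟨ *-monoʳ-≤ (fromℕ-nonNegative 1000) (hire≤1 _ _ _) ⟩
        fromℕ 1000 * 1#                               ≈⟨ *-identityʳ _ ⟩
        fromℕ 1000                                    ∎

    -- From ratio guarantees to inequalities without division

    optimal-when-exact : ∀ C → 0# < C → (∀ I → ratio A I ≥ 1# - C * ε I) →
      Best-when-exact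
    optimal-when-exact C 0<C consistent = begin
      fromℕ 2                             ≈⟨ *-identityˡ _ ⟨
      -- Candidate 0 carries the value 2, and the ratio is at least 1 because `C * ε I ≤ 0`.
      1# * fromℕ 2                        ≤⟨ ratio-lower⇒ A I (<⇒≤ 0<1) 1≤r 0F ⟩
      expectedValue A I                   ∎
      where
      I = instance₃ predicted
      C*ε≤0 : C * ε I ≤ 0#
      C*ε≤0 = begin
        C * ε I  ≤⟨ *-monoʳ-≤ (<⇒≤ 0<C) (exact⇒ε≤0 I (λ _ → refl)) ⟩
        C * 0#   ≈⟨ zeroʳ C ⟩
        0#       ∎
      1≤r : 1# ≤ ratio A I
      1≤r = ≤-trans (+-cancelˡ-≤ (C * ε I) (begin
        C * ε I + 1#              ≤⟨ +-mono-≤ C*ε≤0 (≤-reflexive refl) ⟩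
        0# + 1#                   ≈⟨ +-identityˡ 1# ⟩
        1#                        ≈⟨ x+y-x≈y (C * ε I) 1# ⟨
        C * ε I + (1# - C * ε I)  ∎)) (consistent I)

    -- Clears both the denominator 1000 and the maximum, which gives the form used along the levels.
    348/1000<ratio⇒ : (∀ I → fromℕ 348 / fromℕ⁺ 1000 < ratio A I) →
      ∀ I i → fromℕ 348 * proj₁ (Instance.value I i) ≤ fromℕ 1000 * expectedValue A I
    348/1000<ratio⇒ above I i = begin
      fromℕ 348 * v         ≈⟨ *-congʳ (/-cancel _ (fromℕ⁺ 1000)) ⟨
      fromℕ 1000 * b * v    ≈⟨ *-assoc _ b v ⟩
      fromℕ 1000 * (b * v)  ≤⟨ *-monoʳ-≤ (fromℕ-nonNegative 1000) (ratio-lower⇒ A I 0≤b (<⇒≤ (above I)) i) ⟩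
      fromℕ 1000 * expectedValue A I ∎
      where
      b = fromℕ 348 / fromℕ⁺ 1000
      v = proj₁ (Instance.value I i)
      0≤b : 0# ≤ b
      0≤b = *-cancelˡ-≤ (fromℕ-positive 1000) (begin
        fromℕ 1000 * 0#  ≈⟨ zeroʳ _ ⟩
        0#               ≤⟨ fromℕ-nonNegative 348 ⟩
        fromℕ 348        ≈⟨ /-cancel _ (fromℕ⁺ 1000) ⟨
        fromℕ 1000 * b   ∎)

theorem3 : ∀ {c ℓ₁ ℓ₂} (ℝ : RealNumbers c ℓ₁ ℓ₂) →
    let open Secretary ℝ in
    (C : Carrier) → 0# < C →
    ¬ (∃ λ (A : Algorithm) → ∀ (I : Instance) →
    ratio A I ≥ 1# - C * ε I  ×  fromℕ 348 / fromℕ⁺ 1000 < ratio A I)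
theorem3 ℝ C 0<C (A , guarantee) =
    -- The consistency half makes the hire of candidate 0 sure; the half about 0.348 then drives the
    -- growth beyond 1.
    ratio-bounded A (best-hired A (optimal-when-exact A C 0<C (proj₁ ∘ guarantee)))
      (348/1000<ratio⇒ A (proj₂ ∘ guarantee))
  where open SecretaryProperties ℝ
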